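{- For every formula $\varphi\in\mathcal{L}$: if $\vdash_{\mathsf{IM}}\varphi$, then the sequent $\varphi^\circ$ is derivable in the calculus $\mathcal{C}_{\mathsf{IM}}$.
   Context: Language: $\mathcal{L}$ is generated by $\varphi ::= p \mid \bot \mid \varphi\wedge\varphi \mid \varphi\vee\varphi \mid \varphi\to\varphi \mid \Box\varphi \mid \Diamond\varphi$; $\neg\varphi := \varphi\to\bot$, $\top := \neg\bot$. Logic: $\mathsf{IM}$ is obtained by extending an axiomatisation of intuitionistic propositional logic over $\mathcal{L}$ with the rules "from $\varphi\to\psi$ infer $\Box\varphi\to\Box\psi$" and "from $\varphi\to\psi$ infer $\Diamond\varphi\to\Diamond\psi$" and the axioms $(\Box\varphi\wedge\Diamond\neg\varphi)\to\bot$ and $(\Box\top\to\Diamond\varphi)\to\Diamond\varphi$, closed under modus ponens and uniform substitution. $\vdash_{\mathsf{IM}}\varphi$ means $\varphi$ is a theorem of $\mathsf{IM}$. Sequents: a marked formula is an input formula $\varphi^\bullet$ or an output formula $\varphi^\circ$ with $\varphi\in\mathcal{L}$. A block is $\{\Delta\}$ where $\Delta$ contains at most one marked formula; it is an input block if $\Delta=\varphi^\bullet$ or $\Delta$ is empty, and an output block if $\Delta=\varphi^\circ$. A sequent has the form $\Gamma=\Lambda,\Pi$ where $\Lambda$ is a finite multiset of input formulas and input blocks and $\Pi$ is empty, or one output formula $\varphi^\circ$, or one output block $\{\varphi^\circ\}$. Below $\Gamma$ ranges over sequents, $\Lambda$ over sequents with only input components, $|\Delta|$ is the number of formulas in $\Delta$,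 and all rule instances must consist of sequents. The output pruning $\Gamma^\downarrow$ is $\Gamma$ with its output formula (if any) removed; if the output formula is inside a block, the block is kept but emptied to $\{\ \}$. Rules of $\mathcal{C}_{\mathsf{IM}}$ (premisses / conclusion): $\bot^\bullet$: (no premiss) / $\Gamma,\bot^\bullet$. $\mathsf{id}$: (no premiss) / $\Lambda,p^\bullet,p^\circ$ ($p$ a proposition letter). $\wedge^\bullet$: $\Gamma,\varphi^\bullet,\psi^\bullet$ / $\Gamma,(\varphi\wedge\psi)^\bullet$. $\wedge^\circ$: $\Lambda,\varphi^\circ$ and $\Lambda,\psi^\circ$ / $\Lambda,(\varphi\wedge\psi)^\circ$. $\vee^\bullet$: $\Gamma,\varphi^\bullet$ and $\Gamma,\psi^\bullet$ / $\Gamma,(\varphi\vee\psi)^\bullet$. $\vee^\circ$: $\Lambda,\varphi^\circ$ / $\Lambda,(\varphi\vee\psi)^\circ$; and $\Lambda,\psi^\circ$ / $\Lambda,(\varphi\vee\psi)^\circ$. $\to^\bullet$: $\Gamma^\downarrow,(\varphi\to\psi)^\bullet,\varphi^\circ$ and $\Gamma,\psi^\bullet$ / $\Gamma,(\varphi\to\psi)^\bullet$. $\to^\circ$: $\Lambda,\varphi^\bullet,\psi^\circ$ / $\Lambda,(\varphi\to\psi)^\circ$. $\Box^\bullet$: $\Gamma,\{\varphi^\bullet\}$ / $\Gamma,(\Box\varphi)^\bullet$. $\Box^\circ$ ($|\Delta|\leq 1$): $\Delta,\varphi^\circ$ / $\Lambda,\{\Delta\},(\Box\varphi)^\circ$.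 $\Diamond^\bullet$ ($|\Delta|\leq 1$): $\varphi^\bullet,\Delta$ / $\Gamma,(\Diamond\varphi)^\bullet,\{\Delta\}$. $\Diamond^\circ$: $\Lambda,\{\varphi^\circ\}$ / $\Lambda,(\Diamond\varphi)^\circ$. -}

module Defs where

open import Data.Nat using (ℕ)
open import Data.List using (List; []; _∷_)
open import Data.Maybe using (Maybe; just; nothing)
open import Data.List.Relation.Binary.Permutation.Propositional using (_↭_)

infix  30 □_ ◇_ ¬_
infixl 25 _∧_
infixl 24 _∨_
infixr 23 _⇒_

data Formula : Set where
  var         : ℕ → Formula
  ⊥           : Formula
  _∧_ _∨_ _⇒_ : Formula → Formula → Formula
  □_ ◇_       : Formula → Formula

¬_ : Formula → Formula
¬ φ = φ ⇒ ⊥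

⊤ : Formula
⊤ = ¬ ⊥

Substitution : Set
Substitution = ℕ → Formula

_[_] : Formula → Substitution → Formula
var p   [ σ ] = σ p
⊥       [ σ ] = ⊥
(φ ∧ ψ) [ σ ] = (φ [ σ ]) ∧ (ψ [ σ ])
(φ ∨ ψ) [ σ ] = (φ [ σ ]) ∨ (ψ [ σ ])
(φ ⇒ ψ) [ σ ] = (φ [ σ ]) ⇒ (ψ [ σ ])
(□ φ)   [ σ ] = □ (φ [ σ ])
(◇ φ)   [ σ ] = ◇ (φ [ σ ])

infix 3 ⊢IM_

data ⊢IM_ : Formula → Set where
  ⇒-K     : ∀ {φ ψ}   → ⊢IM φ ⇒ ψ ⇒ φ
  ⇒-S     : ∀ {φ ψ χ} → ⊢IM (φ ⇒ ψ ⇒ χ) ⇒ (φ ⇒ ψ) ⇒ φ ⇒ χ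
  ∧-elimˡ : ∀ {φ ψ}   → ⊢IM φ ∧ ψ ⇒ φ
  ∧-elimʳ : ∀ {φ ψ}   → ⊢IM φ ∧ ψ ⇒ ψ
  ∧-intro : ∀ {φ ψ}   → ⊢IM φ ⇒ ψ ⇒ φ ∧ ψ
  ∨-introˡ : ∀ {φ ψ}  → ⊢IM φ ⇒ φ ∨ ψ
  ∨-introʳ : ∀ {φ ψ}  → ⊢IM ψ ⇒ φ ∨ ψ
  ∨-elim  : ∀ {φ ψ χ} → ⊢IM (φ ⇒ χ) ⇒ (ψ ⇒ χ) ⇒ φ ∨ ψ ⇒ χ
  ⊥-elim  : ∀ {φ}     → ⊢IM ⊥ ⇒ φ
  □◇-⊥    : ∀ {φ}     → ⊢IM (□ φ ∧ ◇ ¬ φ) ⇒ ⊥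
  □⊤-◇    : ∀ {φ}     → ⊢IM (□ ⊤ ⇒ ◇ φ) ⇒ ◇ φ
  mp      : ∀ {φ ψ}   → ⊢IM φ ⇒ ψ → ⊢IM φ → ⊢IM ψ
  □-mono  : ∀ {φ ψ}   → ⊢IM φ ⇒ ψ → ⊢IM □ φ ⇒ □ ψ
  ◇-mono  : ∀ {φ ψ}   → ⊢IM φ ⇒ ψ → ⊢IM ◇ φ ⇒ ◇ ψ
  usub    : ∀ {φ} (σ : Substitution) → ⊢IM φ → ⊢IM φ [ σ ]

-- block• (just φ) is {φ•} and block• nothing is the empty block { }.
data Input : Set where
  _•     : Formula → Input
  block• : Maybe Formula → Input

data Output : Set where
  none   : Output
  _∘     : Formula → Output
  block∘ : Formula → Output

-- Λ ▹ Π is the sequent Λ, Π.  The multiset Λ is represented by a list; lists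
-- are identified up to permutation by the rule exch of the calculus.
infix 4 _▹_
infix 20 _• _∘ _↓

record Sequent : Set where
  constructor _▹_
  field
    inputs : List Input
    output : Output

-- Pruning an output block leaves an empty block, which is an input block.
_↓ : Sequent → List Input
(Λ ▹ none)     ↓ = Λ
(Λ ▹ φ ∘)      ↓ = Λ
(Λ ▹ block∘ φ) ↓ = block• nothing ∷ Λ

-- The content Δ of an input block {Δ}, as a multiset of components.
content : Maybe Formula → List Input
content nothing  = []
content (just φ) = φ • ∷ []

infix 3 ⊢C_

-- Since every rule instance consists of sequents, the block {Δ} in □∘ is an
-- input block; in ◇• it is either an input block (◇•ᵢ, where the context may
-- still contain an output) or the unique output (◇•ₒ).
data ⊢C_ : Sequent → Set where
  exch : ∀ {Λ Λ′ Π} → Λ ↭ Λ′ → ⊢C Λ ▹ Π → ⊢C Λ′ ▹ Π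

  ⊥•   : ∀ {Λ Π} → ⊢C ⊥ • ∷ Λ ▹ Π
  ax   : ∀ {Λ p} → ⊢C var p • ∷ Λ ▹ var p ∘

  ∧•   : ∀ {Λ Π φ ψ} → ⊢C φ • ∷ ψ • ∷ Λ ▹ Π → ⊢C (φ ∧ ψ) • ∷ Λ ▹ Π
  ∧∘   : ∀ {Λ φ ψ} → ⊢C Λ ▹ φ ∘ → ⊢C Λ ▹ ψ ∘ → ⊢C Λ ▹ (φ ∧ ψ) ∘

  ∨•   : ∀ {Λ Π φ ψ} → ⊢C φ • ∷ Λ ▹ Π → ⊢C ψ • ∷ Λ ▹ Π →
         ⊢C (φ ∨ ψ) • ∷ Λ ▹ Π
  ∨∘₁  : ∀ {Λ φ ψ} → ⊢C Λ ▹ φ ∘ → ⊢C Λ ▹ (φ ∨ ψ) ∘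
  ∨∘₂  : ∀ {Λ φ ψ} → ⊢C Λ ▹ ψ ∘ → ⊢C Λ ▹ (φ ∨ ψ) ∘

  ⇒•   : ∀ {Λ Π φ ψ} → ⊢C (φ ⇒ ψ) • ∷ (Λ ▹ Π) ↓ ▹ φ ∘ → ⊢C ψ • ∷ Λ ▹ Π →
         ⊢C (φ ⇒ ψ) • ∷ Λ ▹ Π
  ⇒∘   : ∀ {Λ φ ψ} → ⊢C φ • ∷ Λ ▹ ψ ∘ → ⊢C Λ ▹ (φ ⇒ ψ) ∘

  □•   : ∀ {Λ Π φ} → ⊢C block• (just φ) ∷ Λ ▹ Π → ⊢C (□ φ) • ∷ Λ ▹ Π
  □∘   : ∀ {Λ Δ φ} → ⊢C content Δ ▹ φ ∘ → ⊢C block• Δ ∷ Λ ▹ (□ φ) ∘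

  ◇•ᵢ  : ∀ {Λ Π Δ φ} → ⊢C φ • ∷ content Δ ▹ none →
         ⊢C (◇ φ) • ∷ block• Δ ∷ Λ ▹ Π
  ◇•ₒ  : ∀ {Λ φ ψ} → ⊢C φ • ∷ [] ▹ ψ ∘ → ⊢C (◇ φ) • ∷ Λ ▹ block∘ ψ
  ◇∘   : ∀ {Λ φ} → ⊢C Λ ▹ block∘ φ → ⊢C Λ ▹ (◇ φ) ∘

{-# OPTIONS --safe #-}
-- Cut is eliminated semantically.  Formulas are interpreted as predicates on
-- cut-free contexts, closed under "every sequent derivable from all extensions
-- satisfying the predicate is derivable".  A context containing φ• satisfies φ,
-- and a context satisfying φ derives φ∘; since IM is sound for this
-- interpretation, its theorems hold in the empty context.
module Submission where

open import Data.List using (List; []; _∷_)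
open import Data.List.Membership.Propositional using (_∈_)
open import Data.List.Membership.Propositional.Properties using (∈-∃++)
open import Data.List.Relation.Binary.Permutation.Propositional
  using (_↭_; ↭-reflexive; ↭-sym; ↭-trans)
open import Data.List.Relation.Binary.Permutation.Propositional.Properties
  using (∈-resp-↭; shift)
open import Data.List.Relation.Binary.Subset.Propositional using (_⊆_)
open import Data.List.Relation.Binary.Subset.Propositional.Properties using (∷⁺ʳ)
open import Data.List.Relation.Unary.Any using (here; there)
open import Data.Maybe using (just; nothing)
open import Data.Product using (∃-syntax; _×_; _,_; proj₁; proj₂)
open import Data.Sum using (_⊎_; inj₁; inj₂)
open import Function using (id; _∘′_)
open import Relation.Binary.PropositionalEquality
  using (_≡_; refl; cong; cong₂; subst; sym)
open import Defs

private variable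
  Λ Λ′ : List Input
  Π Π′ : Output
  φ ψ : Formula
  i : Input

-- Structural rules

-- i ◁ Λ says that Λ contains what is left of i after some left rules have been
-- applied to it backwards.  Derivability is monotone along this relation, which
-- yields weakening, contraction and the inversions in a single induction.
infix 4 _◁_ _⊑_ _≼_

data _◁_ : Input → List Input → Set where
  member : i ∈ Λ → i ◁ Λ
  and    : φ • ◁ Λ → ψ • ◁ Λ → (φ ∧ ψ) • ◁ Λ
  orˡ    : φ • ◁ Λ → (φ ∨ ψ) • ◁ Λ
  orʳ    : ψ • ◁ Λ → (φ ∨ ψ) • ◁ Λ
  imp    : ψ • ◁ Λ → (φ ⇒ ψ) • ◁ Λ
  box    : block• (just φ) ◁ Λ → (□ φ) • ◁ Λ
  empty  : ∀ {Δ} → block• Δ ◁ Λ → block• nothing ◁ Λ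

_⊑_ : List Input → List Input → Set
Λ ⊑ Λ′ = ∀ {i} → i ∈ Λ → i ◁ Λ′

-- Puts weakening on the right into the same induction; this is what turns a `◇•ᵢ` inference, whose
-- premise has no output, into a `◇•ₒ` inference.
data _≼_ : Output → Output → Set where
  none≼ : none ≼ Π
  same  : Π ≼ Π

◁-⊑ : i ◁ Λ → Λ ⊑ Λ′ → i ◁ Λ′
◁-⊑ (member m) s = s m
◁-⊑ (and c d)  s = and (◁-⊑ c s) (◁-⊑ d s)
◁-⊑ (orˡ c)    s = orˡ (◁-⊑ c s)
◁-⊑ (orʳ c)    s = orʳ (◁-⊑ c s)
◁-⊑ (imp c)    s = imp (◁-⊑ c s)
◁-⊑ (box c)    s = box (◁-⊑ c s)
◁-⊑ (empty c)  s = empty (◁-⊑ c s)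

⊑-trans : ∀ {Λ″} → Λ ⊑ Λ′ → Λ′ ⊑ Λ″ → Λ ⊑ Λ″
⊑-trans s t m = ◁-⊑ (s m) t

⊆⇒⊑ : Λ ⊆ Λ′ → Λ ⊑ Λ′
⊆⇒⊑ s m = member (s m)

⊑-cons : i ◁ Λ′ → Λ ⊑ Λ′ → i ∷ Λ ⊑ Λ′
⊑-cons c s (here refl) = c
⊑-cons c s (there m)   = s m

⊑-keep : Λ ⊑ Λ′ → i ∷ Λ ⊑ i ∷ Λ′
⊑-keep s = ⊑-cons (member (here refl)) (⊑-trans s (⊆⇒⊑ there))

⊆-↓ : ∀ Π → Λ ⊆ (Λ ▹ Π) ↓
⊆-↓ none       m = m
⊆-↓ (φ ∘)      m = m
⊆-↓ (block∘ φ) m = there m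

↓-⊑ : ∀ Π → Λ ⊑ Λ′ → (Λ ▹ Π) ↓ ⊑ (Λ′ ▹ Π) ↓
↓-⊑ none       s = s
↓-⊑ (φ ∘)      s = s
↓-⊑ (block∘ φ) s = ⊑-keep s

↓-≼ : Π ≼ Π′ → Λ ⊑ (Λ′ ▹ Π′) ↓ → (Λ ▹ Π) ↓ ⊑ (Λ′ ▹ Π′) ↓
↓-≼               none≼ s = s
↓-≼ {Π = none}     same s = s
↓-≼ {Π = φ ∘}      same s = s
↓-≼ {Π = block∘ φ} same s = ⊑-cons (member (here refl)) s

•∈↓ : ∀ Π → φ • ∈ (Λ ▹ Π) ↓ → φ • ∈ Λ
•∈↓ none       m         = m
•∈↓ (φ ∘)      m         = m
•∈↓ (block∘ φ) (there m) = m

extract : i ∈ Λ → ∃[ Λ′ ] Λ ↭ i ∷ Λ′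
extract m with xs , ys , e ← ∈-∃++ m = _ , ↭-trans (↭-reflexive e) (shift _ xs ys)

replace : Λ ↭ i ∷ Λ′ → ∀ {Λ″} → i ◁ Λ″ → Λ′ ⊆ Λ″ → Λ ⊑ Λ″
replace p c s m = ⊑-cons c (⊆⇒⊑ s) (∈-resp-↭ p m)

-- Only `member` and `empty` can cover a block, and `empty` leaves no content to match, so whatever
-- block it starts from will do.
◁-block : ∀ {Δ} → block• Δ ◁ Λ →
          ∃[ Δ′ ] block• Δ′ ∈ Λ × content Δ ⊆ content Δ′
◁-block (member m) = _ , m , id
◁-block (empty c) with Δ′ , m , _ ← ◁-block c = Δ′ , m , λ ()

-- The covering context is (Λ′ ▹ Π′) ↓ because an input block { } is redundant next to
-- an output block; this is the content of the axiom (□⊤ → ◇φ) → ◇φ.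
mono : ⊢C Λ ▹ Π → Λ ⊑ (Λ′ ▹ Π′) ↓ → Π ≼ Π′ → ⊢C Λ′ ▹ Π′

⊥•-mono : ⊥ • ◁ (Λ′ ▹ Π′) ↓ → ⊢C Λ′ ▹ Π′
⊥•-mono {Π′ = Π′} (member m) with _ , p ← extract (•∈↓ Π′ m) = exch (↭-sym p) ⊥•

ax-mono : ∀ {p} → var p • ◁ Λ′ → ⊢C Λ′ ▹ var p ∘
ax-mono (member m) with _ , p ← extract m = exch (↭-sym p) ax

-- If the conjunction is still present, the rule is reapplied, and `replace` lets the conjuncts
-- stand for it wherever the covering used it. If it is already decomposed, the inference
-- disappears. The left rules for `∨`, `⇒` and `□` follow the same pattern.
∧•-mono : ⊢C φ • ∷ ψ • ∷ Λ ▹ Π → (φ ∧ ψ) • ◁ (Λ′ ▹ Π′) ↓ →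
          Λ ⊑ (Λ′ ▹ Π′) ↓ → Π ≼ Π′ → ⊢C Λ′ ▹ Π′
∧•-mono {Π′ = Π′} d (member m) s o with _ , p ← extract (•∈↓ Π′ m) =
  exch (↭-sym p) (∧• (mono d
    (⊑-cons (member (⊆-↓ Π′ (here refl)))
      (⊑-cons (member (⊆-↓ Π′ (there (here refl))))
        (⊑-trans s (↓-⊑ Π′ (replace p
          (and (member (here refl)) (member (there (here refl))))
          (there ∘′ there)))))) o))
∧•-mono d (and c₁ c₂) s o = mono d (⊑-cons c₁ (⊑-cons c₂ s)) o

∨•-mono : ⊢C φ • ∷ Λ ▹ Π → ⊢C ψ • ∷ Λ ▹ Π → (φ ∨ ψ) • ◁ (Λ′ ▹ Π′) ↓ →
          Λ ⊑ (Λ′ ▹ Π′) ↓ → Π ≼ Π′ → ⊢C Λ′ ▹ Π′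
∨•-mono {Π′ = Π′} d e (member m) s o with _ , p ← extract (•∈↓ Π′ m) =
  exch (↭-sym p) (∨•
    (mono d (⊑-cons (member (⊆-↓ Π′ (here refl)))
      (⊑-trans s (↓-⊑ Π′ (replace p (orˡ (member (here refl))) there)))) o)
    (mono e (⊑-cons (member (⊆-↓ Π′ (here refl)))
      (⊑-trans s (↓-⊑ Π′ (replace p (orʳ (member (here refl))) there)))) o))
∨•-mono d e (orˡ c) s o = mono d (⊑-cons c s) o
∨•-mono d e (orʳ c) s o = mono e (⊑-cons c s) o

⇒•-mono : ⊢C (φ ⇒ ψ) • ∷ (Λ ▹ Π) ↓ ▹ φ ∘ → ⊢C ψ • ∷ Λ ▹ Π →
          (φ ⇒ ψ) • ◁ (Λ′ ▹ Π′) ↓ → Λ ⊑ (Λ′ ▹ Π′) ↓ → Π ≼ Π′ → ⊢C Λ′ ▹ Π′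
⇒•-mono {Π′ = Π′} d e (member m) s o with _ , p ← extract (•∈↓ Π′ m) =
  exch (↭-sym p) (⇒•
    (mono d (⊑-cons (member (here refl))
      (⊑-trans (↓-≼ o s) (⊑-trans (↓-⊑ Π′ (⊆⇒⊑ (∈-resp-↭ p))) (↓-∷ Π′)))) same)
    (mono e (⊑-cons (member (⊆-↓ Π′ (here refl)))
      (⊑-trans s (↓-⊑ Π′ (replace p (imp (member (here refl))) there)))) o))
  where
  ↓-∷ : ∀ Π → (i ∷ Λ ▹ Π) ↓ ⊑ i ∷ (Λ ▹ Π) ↓
  ↓-∷ none       m                   = member m
  ↓-∷ (φ ∘)      m                   = member m
  ↓-∷ (block∘ φ) (here refl)         = member (there (here refl))
  ↓-∷ (block∘ φ) (there (here refl)) = member (here refl)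
  ↓-∷ (block∘ φ) (there (there m))   = member (there (there m))
⇒•-mono d e (imp c) s o = mono e (⊑-cons c s) o

□•-mono : ⊢C block• (just φ) ∷ Λ ▹ Π → (□ φ) • ◁ (Λ′ ▹ Π′) ↓ →
          Λ ⊑ (Λ′ ▹ Π′) ↓ → Π ≼ Π′ → ⊢C Λ′ ▹ Π′
□•-mono {Π′ = Π′} d (member m) s o with _ , p ← extract (•∈↓ Π′ m) =
  exch (↭-sym p) (□• (mono d (⊑-cons (member (⊆-↓ Π′ (here refl)))
    (⊑-trans s (↓-⊑ Π′ (replace p (box (member (here refl))) there)))) o))
□•-mono d (box c) s o = mono d (⊑-cons c s) o

□∘-mono : ∀ {Δ} → ⊢C content Δ ▹ φ ∘ → block• Δ ◁ Λ′ → ⊢C Λ′ ▹ (□ φ) ∘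
□∘-mono d c with Δ′ , m , s ← ◁-block c with _ , p ← extract m =
  exch (↭-sym p) (□∘ {Δ = Δ′} (mono d (⊆⇒⊑ s) same))

◇•ᵢ-∈ : ∀ {Δ} → ⊢C φ • ∷ content Δ ▹ none → (◇ φ) • ∈ Λ → block• Δ ∈ Λ → ⊢C Λ ▹ Π
◇•ᵢ-∈ {φ = φ} {Δ = Δ} d m n with _ , p ← extract m with ∈-resp-↭ p n
... | there n′ with _ , q ← extract n′ =
  exch (↭-sym (↭-trans p (_↭_.prep _ q))) (◇•ᵢ {Δ = Δ} d)

◇•ᵢ-mono : ∀ {Δ} → ⊢C φ • ∷ content Δ ▹ none → (◇ φ) • ◁ (Λ′ ▹ Π′) ↓ →
           block• Δ ◁ (Λ′ ▹ Π′) ↓ → ⊢C Λ′ ▹ Π′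
◇•ᵢ-mono {Π′ = Π′} d (member m) c with Δ′ , n , s ← ◁-block c =
  step Π′ n (•∈↓ Π′ m)
  where
  step : ∀ Π → block• Δ′ ∈ (Λ ▹ Π) ↓ → (◇ _) • ∈ Λ → ⊢C Λ ▹ Π
  step none       n m = ◇•ᵢ-∈ {Δ = Δ′} (mono d (⊆⇒⊑ (∷⁺ʳ _ s)) same) m n
  step (χ ∘)      n m = ◇•ᵢ-∈ {Δ = Δ′} (mono d (⊆⇒⊑ (∷⁺ʳ _ s)) same) m n
  step (block∘ χ) (there n) m = ◇•ᵢ-∈ {Δ = Δ′} (mono d (⊆⇒⊑ (∷⁺ʳ _ s)) same) m n
  -- The covering block is the one left by pruning, so the diamond acts on the output block itself
  -- and the premise is weakened to output `χ ∘`.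
  step (block∘ χ) (here refl) m with _ , p ← extract m =
    exch (↭-sym p) (◇•ₒ (mono d (⊆⇒⊑ (∷⁺ʳ _ s)) none≼))

◇•ₒ-mono : ⊢C φ • ∷ [] ▹ ψ ∘ → (◇ φ) • ◁ block• nothing ∷ Λ′ → ⊢C Λ′ ▹ block∘ ψ
◇•ₒ-mono d (member (there m)) with _ , p ← extract m = exch (↭-sym p) (◇•ₒ d)

mono (exch p d)   s o    = mono d (s ∘′ ∈-resp-↭ p) o
mono ⊥•           s o    = ⊥•-mono (s (here refl))
mono ax           s same = ax-mono (s (here refl))
mono (∧• d)       s o    = ∧•-mono d (s (here refl)) (s ∘′ there) o
mono (∧∘ d e)     s same = ∧∘ (mono d s same) (mono e s same)
mono (∨• d e)     s o    = ∨•-mono d e (s (here refl)) (s ∘′ there) o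
mono (∨∘₁ d)      s same = ∨∘₁ (mono d s same)
mono (∨∘₂ d)      s same = ∨∘₂ (mono d s same)
mono (⇒• d e)     s o    = ⇒•-mono d e (s (here refl)) (s ∘′ there) o
mono (⇒∘ d)       s same = ⇒∘ (mono d (⊑-keep s) same)
mono (□• d)       s o    = □•-mono d (s (here refl)) (s ∘′ there) o
mono (□∘ {Δ = Δ} d) s same = □∘-mono {Δ = Δ} d (s (here refl))
mono (◇•ᵢ {Δ = Δ} d) s o = ◇•ᵢ-mono {Δ = Δ} d (s (here refl)) (s (there (here refl)))
mono (◇•ₒ d)      s same = ◇•ₒ-mono d (s (here refl))
mono (◇∘ d)       s same = ◇∘ (mono d (⊑-trans s (⊆⇒⊑ there)) same)

weaken : Λ ⊆ Λ′ → ⊢C Λ ▹ Π → ⊢C Λ′ ▹ Π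
weaken {Π = Π} s d = mono d (⊆⇒⊑ (⊆-↓ Π ∘′ s)) same

-- With `weaken` this gives contraction: a rule acts on a fresh copy of an input, which is then
-- absorbed.
contract : i ∈ Λ → i ∷ Λ ⊆ Λ
contract m (here refl) = m
contract m (there n)   = n

-- Semantics

Pred : Set₁
Pred = List Input → Set

-- Continuation-passing form: left rules may be applied before a witness of `X` is chosen. `Π` is
-- arbitrary because the goal is not known at that point.
Closure : Pred → Pred
Closure X Λ = ∀ {Λ₁} → Λ ⊆ Λ₁ → ∀ Π →
              (∀ {Λ₂} → Λ₁ ⊆ Λ₂ → X Λ₂ → ⊢C Λ₂ ▹ Π) → ⊢C Λ₁ ▹ Π

⟦_⟧ : Formula → Pred
⟦ var p ⟧ Λ = ⊢C Λ ▹ var p ∘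
⟦ ⊥ ⟧     Λ = ∀ Π → ⊢C Λ ▹ Π
⟦ φ ∧ ψ ⟧ Λ = ⟦ φ ⟧ Λ × ⟦ ψ ⟧ Λ
⟦ φ ∨ ψ ⟧   = Closure λ Λ → ⟦ φ ⟧ Λ ⊎ ⟦ ψ ⟧ Λ
⟦ φ ⇒ ψ ⟧ Λ = ∀ {Λ₁} → Λ ⊆ Λ₁ → ⟦ φ ⟧ Λ₁ → ⟦ ψ ⟧ Λ₁
-- As in `□∘`, the rest of the context is discarded and one block alone must support `φ`.
⟦ □ φ ⟧     = Closure λ Λ → ∃[ Δ ] block• Δ ∈ Λ × ⟦ φ ⟧ (content Δ)
-- The two components mirror the premises of ◇•ₒ and ◇•ᵢ.
⟦ ◇ φ ⟧ Λ   = ∀ {Λ₁} → Λ ⊆ Λ₁ →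
  (∀ ψ → (∀ {Θ} → ⟦ φ ⟧ Θ → ⊢C Θ ▹ ψ ∘) → ⊢C Λ₁ ▹ block∘ ψ) ×
  (∀ Δ → block• Δ ∈ Λ₁ → (∀ {Θ} → content Δ ⊆ Θ → ⟦ φ ⟧ Θ → ⊢C Θ ▹ none) →
   ∀ Π → ⊢C Λ₁ ▹ Π)

⟦⟧-⊆ : ∀ φ → Λ ⊆ Λ′ → ⟦ φ ⟧ Λ → ⟦ φ ⟧ Λ′
⟦⟧-⊆ (var p) s d       = weaken s d
⟦⟧-⊆ ⊥       s d Π     = weaken s (d Π)
⟦⟧-⊆ (φ ∧ ψ) s (x , y) = ⟦⟧-⊆ φ s x , ⟦⟧-⊆ ψ s y
⟦⟧-⊆ (φ ∨ ψ) s c t     = c (t ∘′ s)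
⟦⟧-⊆ (φ ⇒ ψ) s f t     = f (t ∘′ s)
⟦⟧-⊆ (□ φ)   s c t     = c (t ∘′ s)
⟦⟧-⊆ (◇ φ)   s d t     = d (t ∘′ s)

Closure-map : ∀ {X Y : Pred} → (∀ {Λ₁} → Λ ⊆ Λ₁ → X Λ₁ → Y Λ₁) →
              Closure X Λ → Closure Y Λ
Closure-map f c s Π k = c s Π λ t x → k t (f (t ∘′ s) x)

Closure-unit : ∀ {X : Pred} → (∀ {Λ₁} → Λ ⊆ Λ₁ → X Λ₁) → Closure X Λ
Closure-unit x s Π k = k id (x s)

Closure-join : ∀ {X : Pred} → Closure (Closure X) Λ → Closure X Λ
Closure-join c s Π k = c s Π λ t d → d id Π λ u x → k (u ∘′ t) x

-- Allows left rules and case distinctions under any goal formula. For `var`, `⊥` and `◇` the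
-- meaning ends in derivability, which serves as the choice of `Π`; `∨` and `□` are closures
-- already.
⟦⟧-closed : ∀ φ → Closure ⟦ φ ⟧ Λ → ⟦ φ ⟧ Λ
⟦⟧-closed (var p) c   = c id (var p ∘) λ _ d → d
⟦⟧-closed ⊥       c Π = c id Π λ _ d → d Π
⟦⟧-closed (φ ∧ ψ) c   = ⟦⟧-closed φ (Closure-map (λ _ → proj₁) c) ,
                        ⟦⟧-closed ψ (Closure-map (λ _ → proj₂) c)
⟦⟧-closed (φ ∨ ψ) c   = Closure-join c
⟦⟧-closed (φ ⇒ ψ) c s x =
  ⟦⟧-closed ψ λ t → Closure-map (λ u f → f id (⟦⟧-⊆ φ u x)) (λ v → c (v ∘′ s)) t
⟦⟧-closed (□ φ)   c   = Closure-join c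
⟦⟧-closed (◇ φ)   c s =
  (λ ψ k → c s (block∘ ψ) λ _ d → proj₁ (d id) ψ k) ,
  (λ Δ m k Π → c s Π λ t d → proj₂ (d id) Δ (t m) k Π)

-- The two directions are mutual because of implication: `⇒∘` needs the antecedent reflected, and
-- the first premise of `⇒•` needs it reified.
reify   : ∀ φ → ⟦ φ ⟧ Λ → ⊢C Λ ▹ φ ∘
reflect : ∀ φ → φ • ∈ Λ → ⟦ φ ⟧ Λ

reify (var p) d       = d
reify ⊥       d       = d (⊥ ∘)
reify (φ ∧ ψ) (x , y) = ∧∘ (reify φ x) (reify ψ y)
reify (φ ∨ ψ) c       = c id _ λ where
  _ (inj₁ x) → ∨∘₁ (reify φ x)
  _ (inj₂ y) → ∨∘₂ (reify ψ y)
reify (φ ⇒ ψ) f       = ⇒∘ (reify ψ (f there (reflect φ (here refl))))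
reify (□ φ)   c       = c id _ λ where
  _ (Δ , m , x) → weaken (contract m) (□∘ {Δ = Δ} (reify φ x))
reify (◇ φ)   d       = ◇∘ (proj₁ (d id) φ (reify φ))

reflect (var p) m   = weaken (contract m) ax
reflect ⊥       m Π = weaken (contract m) ⊥•
reflect (φ ∧ ψ) m   =
  ⟦⟧-closed φ (λ s Π k → weaken (contract (s m))
    (∧• (k (there ∘′ there) (reflect φ (here refl))))) ,
  ⟦⟧-closed ψ (λ s Π k → weaken (contract (s m))
    (∧• (k (there ∘′ there) (reflect ψ (there (here refl))))))
reflect (φ ∨ ψ) m s Π k = weaken (contract (s m))
  (∨• (k there (inj₁ (reflect φ (here refl))))
      (k there (inj₂ (reflect ψ (here refl)))))
reflect (φ ⇒ ψ) m s x = ⟦⟧-closed ψ λ t Π k → weaken (contract (t (s m)))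
  (⇒• (weaken (there ∘′ ⊆-↓ Π ∘′ t) (reify φ x))
      (k there (reflect ψ (here refl))))
reflect (□ φ)   m s Π k = weaken (contract (s m))
  (□• (k there (just φ , here refl , reflect φ (here refl))))
reflect (◇ φ)   m s =
  (λ ψ k → weaken (contract (s m)) (◇•ₒ (k (reflect φ (here refl))))) ,
  (λ Δ n k Π → ◇•ᵢ-∈ {Δ = Δ} (k there (reflect φ (here refl))) (s m) n)

-- Soundness of IM

[]-comp : ∀ φ (σ τ : Substitution) → φ [ σ ] [ τ ] ≡ φ [ (λ p → σ p [ τ ]) ]
[]-comp (var p) σ τ = refl
[]-comp ⊥       σ τ = refl
[]-comp (φ ∧ ψ) σ τ = cong₂ _∧_ ([]-comp φ σ τ) ([]-comp ψ σ τ)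
[]-comp (φ ∨ ψ) σ τ = cong₂ _∨_ ([]-comp φ σ τ) ([]-comp ψ σ τ)
[]-comp (φ ⇒ ψ) σ τ = cong₂ _⇒_ ([]-comp φ σ τ) ([]-comp ψ σ τ)
[]-comp (□ φ)   σ τ = cong □_ ([]-comp φ σ τ)
[]-comp (◇ φ)   σ τ = cong ◇_ ([]-comp φ σ τ)

[]-id : ∀ φ → φ [ var ] ≡ φ
[]-id (var p) = refl
[]-id ⊥       = refl
[]-id (φ ∧ ψ) = cong₂ _∧_ ([]-id φ) ([]-id ψ)
[]-id (φ ∨ ψ) = cong₂ _∨_ ([]-id φ) ([]-id ψ)
[]-id (φ ⇒ ψ) = cong₂ _⇒_ ([]-id φ) ([]-id ψ)
[]-id (□ φ)   = cong □_ ([]-id φ)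
[]-id (◇ φ)   = cong ◇_ ([]-id φ)

⟦⟧-∨-elim : ∀ φ ψ χ → ⟦ (φ ⇒ χ) ⇒ (ψ ⇒ χ) ⇒ φ ∨ ψ ⇒ χ ⟧ Λ
⟦⟧-∨-elim φ ψ χ _ f s g t c = ⟦⟧-closed χ (Closure-map cases c)
  where
  cases : ∀ {Λ₁} → _ ⊆ Λ₁ → ⟦ φ ⟧ Λ₁ ⊎ ⟦ ψ ⟧ Λ₁ → ⟦ χ ⟧ Λ₁
  cases u (inj₁ x) = f (u ∘′ t ∘′ s) x
  cases u (inj₂ y) = g (u ∘′ t) y

-- The diamond is applied to the block that witnesses `□ φ`: every extension of its content that
-- satisfies `¬ φ` satisfies `φ` as well.
⟦⟧-□◇-⊥ : ∀ φ → ⟦ (□ φ ∧ ◇ ¬ φ) ⇒ ⊥ ⟧ Λ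
⟦⟧-□◇-⊥ φ _ (b , d) Π = b id Π λ where
  s (Δ , m , x) → proj₂ (d s) Δ m (λ t f → f id (⟦⟧-⊆ φ t x) none) Π

-- An empty block is adjoined to make `□ ⊤` true, and `mono` removes it again: it is covered by the
-- pruned output block in the first component and by the given block `Δ` in the second.
⟦⟧-□⊤-◇ : ∀ φ → ⟦ (□ ⊤ ⇒ ◇ φ) ⇒ ◇ φ ⟧ Λ
⟦⟧-□⊤-◇ φ _ f s =
  (λ ψ k → mono (proj₁ (d id) ψ k) (⊆⇒⊑ id) same) ,
  (λ Δ m k Π → mono (proj₂ (d id) Δ (there m) k Π)
    (⊑-cons (empty (member (⊆-↓ Π m))) (⊆⇒⊑ (⊆-↓ Π))) same)
  where
  d : ⟦ ◇ φ ⟧ (block• nothing ∷ _)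
  d = f (there ∘′ s) λ t Π k → k id (nothing , t (here refl) , λ _ x → x)

-- Quantifying over `σ` reduces `usub` to composing substitutions; quantifying over `Λ` lets the
-- monotonicity rules use their premise inside a block.
sound : ⊢IM φ → ∀ σ {Λ} → ⟦ φ [ σ ] ⟧ Λ
sound (⇒-K {φ})         σ _ x s _         = ⟦⟧-⊆ (φ [ σ ]) s x
sound ⇒-S               σ _ f s g t x     = f (t ∘′ s) x id (g t x)
sound ∧-elimˡ           σ _               = proj₁
sound ∧-elimʳ           σ _               = proj₂
sound (∧-intro {φ})     σ _ x s y         = ⟦⟧-⊆ (φ [ σ ]) s x , y
sound (∨-introˡ {φ})    σ _ x             = Closure-unit λ s → inj₁ (⟦⟧-⊆ (φ [ σ ]) s x)
sound (∨-introʳ {ψ = ψ}) σ _ y            = Closure-unit λ s → inj₂ (⟦⟧-⊆ (ψ [ σ ]) s y)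
sound (∨-elim {φ} {ψ} {χ}) σ              = ⟦⟧-∨-elim (φ [ σ ]) (ψ [ σ ]) (χ [ σ ])
sound (⊥-elim {φ})      σ _ d             = ⟦⟧-closed (φ [ σ ]) λ s Π _ → weaken s (d Π)
sound (□◇-⊥ {φ})        σ                 = ⟦⟧-□◇-⊥ (φ [ σ ])
sound (□⊤-◇ {φ})        σ                 = ⟦⟧-□⊤-◇ (φ [ σ ])
sound (mp d e)          σ                 = sound d σ id (sound e σ)
sound (□-mono d)        σ _               = Closure-map λ where
  _ (Δ , m , x) → Δ , m , sound d σ id x
sound (◇-mono d)        σ _ x s           =
  (λ χ k → proj₁ (x s) χ (k ∘′ sound d σ id)) ,
  (λ Δ m k → proj₂ (x s) Δ m λ t → k t ∘′ sound d σ id)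
sound (usub {φ} τ d)    σ {Λ}             =
  subst (λ χ → ⟦ χ ⟧ Λ) (sym ([]-comp φ τ σ)) (sound d (λ p → τ p [ σ ]))

theorem3p13 : (φ : Formula) → ⊢IM φ → ⊢C ([] ▹ φ ∘)
theorem3p13 φ d = reify φ (subst (λ χ → ⟦ χ ⟧ []) ([]-id φ) (sound d var))
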